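{- For every infinite sequence $n_0n_1n_2\cdots$ of positive integers with $n_0=2$, one has $n_0n_1\cdots\notin\mathrm{ENSH}^2_2$; that is, there exists $r>0$ such that $\mathrm{ENSH}^2_2(n_0\cdots n_{r-1})$ does not hold.
   Context: Identify $2$ with $\{0,1\}$; $2^n$ is the set of binary words of length $n$. A variable word (over $2$) is a sequence $v$ with entries in $\{0,1\}\cup\{x_0,x_1,\dots\}$, the $x_m$ being variables; the first occurrence of a variable $x_m$ occurring in $v$ is $\min\{t:v(t)=x_m\}$. An $n$-variable word is a variable word in which exactly $n$ variables occur, with the convention that the first occurrences are increasing in the variable index. For a finite $n$-variable word $v$ and $\vec a\in 2^n$, $v(\vec a)$ is the binary word obtained by replacing the $j$-th variable occurring in $v$ (in order of index) by $\vec a(j)$, for all $j<n$. Let $n_0,\dots,n_{r-1}$ be positive integers, $N=n_0+\cdots+n_{r-1}$, and $N_s=\{n_0+\cdots+n_{s-1},\dots,n_0+\cdots+n_s-1\}$ for $s\le r-1$. For $f:2^N\to 2$, the sequence $n_0\cdots n_{r-1}$ is sectionally-homogeneous for $f$ if there exist $s\le r-1$ and an $n_s$-variable word $v$ of length $N$ such that the set of first occurrences of the variables occurring in $v$ is exactly $N_s$ and $f$ is constant on $\{v(\vec a):\vec a\in 2^{n_s}\}$. $\mathrm{ENSH}^2_2(n_0\cdots n_{r-1})$ holds if there exists $f:2^N\to 2$ such that $n_0\cdots n_{r-1}$ is not sectionally-homogeneous for $f$. $\mathrm{ENSH}^2_2$ also denotes the set of infinite sequences of positive integers all of whose nonempty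 finite initial segments satisfy $\mathrm{ENSH}^2_2(\cdot)$. -}

module Defs where

open import Data.Bool.Base using (Bool)
open import Data.Fin.Base as Fin using (Fin; toℕ)
open import Data.List.Base as List using (List; length; sum; take; applyUpTo)
open import Data.Nat.Base using (ℕ; _+_; _≤_; _<_)
open import Data.Product.Base using (_×_; _,_; ∃; ∃-syntax; proj₁)
open import Data.Vec.Base as Vec using (Vec; tabulate)
open import Function.Bundles using (_⇔_)
open import Level using (0ℓ)
open import Relation.Binary.PropositionalEquality using (_≡_; refl)
open import Relation.Nullary.Negation using (¬_)
open import Relation.Unary using (Pred)

data Letter : Set where
  const : Bool → Letter
  var   : ℕ → Letter

Occurs : ∀ {N} → Vec Letter N → ℕ → Set
Occurs w m = ∃[ t ] Vec.lookup w t ≡ var m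

FirstOccurrence : ∀ {N} → Vec Letter N → ℕ → Fin N → Set
FirstOccurrence w m t =
  Vec.lookup w t ≡ var m × (∀ t′ → Vec.lookup w t′ ≡ var m → t Fin.≤ t′)

-- An n-variable word of length N. The indices of the occurring variables are
-- arbitrary naturals; `name j` is the j-th of them in increasing order, so
-- that `name` is uniquely determined by `word`.
record VariableWord (n N : ℕ) : Set where
  field
    word             : Vec Letter N
    name             : Fin n → ℕ
    name-increasing  : ∀ {i j} → i Fin.< j → name i < name j
    name-occurs      : ∀ j → Occurs word (name j)
    occurs-name      : ∀ {m} → Occurs word m → ∃[ j ] name j ≡ m
    first-increasing : ∀ {m m′ t t′} →
                       FirstOccurrence word m t → FirstOccurrence word m′ t′ →
                       m < m′ → t Fin.< t′

open VariableWord public using (word)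

-- v(a). The position j found for a variable does not depend on the proof that
-- it occurs, since `name` is injective.
infixl 20 _⟨_⟩

_⟨_⟩ : ∀ {n N} → VariableWord n N → Vec Bool n → Vec Bool N
_⟨_⟩ {n} v a =
  tabulate λ t → value (Vec.lookup (word v) t) λ eq → occurs-name (t , eq)
  where
  open VariableWord v using (name; occurs-name)

  value : (ℓ : Letter) → (∀ {m} → ℓ ≡ var m → ∃[ j ] name j ≡ m) → Bool
  value (const b) _     = b
  value (var m)   index = Vec.lookup a (proj₁ (index refl))

-- The section N_s, as a set of natural numbers.
Section : (ns : List ℕ) → Fin (length ns) → Pred ℕ 0ℓ
Section ns s t = start ≤ t × t < start + List.lookup ns s
  where
  start : ℕ
  start = sum (take (toℕ s) ns)

-- Binary words are vectors rather than functions Fin N → Bool, so that a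
-- colouring cannot distinguish pointwise equal words.
SectionallyHomogeneous : (ns : List ℕ) → (Vec Bool (sum ns) → Bool) → Set
SectionallyHomogeneous ns f =
  ∃[ s ] ∃ λ (v : VariableWord (List.lookup ns s) (sum ns)) →
    (∀ t → (∃[ m ] FirstOccurrence (word v) m t) ⇔ Section ns s (toℕ t)) ×
    (∀ a b → f (v ⟨ a ⟩) ≡ f (v ⟨ b ⟩))

ENSH²₂ : List ℕ → Set
ENSH²₂ ns = ∃[ f ] ¬ SectionallyHomogeneous ns f

ENSH²₂-seq : Pred (ℕ → ℕ) 0ℓ
ENSH²₂-seq n = (∀ i → 0 < n i) × (∀ r → 0 < r → ENSH²₂ (applyUpTo n r))

-- Read words as sets of positions and write A, B, C, D for the colourings f(00·), f(01·),
-- f(10·), f(11·) of the words after the section N₀, of size 2. Suppose no section is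
-- homogeneous. For N₀ this says: no pairwise disjoint P, X, Y have A(P) = B(P ∪ Y) =
-- C(P ∪ X) = D(P ∪ X ∪ Y).
--
-- On two consecutive sections there is a set Y within the first of them such that for both
-- colours b there is P disjoint from Y with A(P) = B(P ∪ Y) = b; otherwise each Y misses a
-- colour, and this makes B constant on a line. Then D(X ∪ Y) ≠ C(X) for all X disjoint from
-- Y containing both P's, so after fixing these sections, D is the negation of C. Doing the
-- same with A and C on the next two sections, D also becomes the negation of B.
--
-- Now put P = ∅ and e = ¬A(∅): the sets with D = e are closed under disjoint unions. In the
-- next section, of size m, choose for each position t a set Yₜ inside a later section of its
-- own with D({t} ∪ Yₜ) = e, and Y′ inside yet another section with D(Y′) = e. Letting Yₜ
-- follow the variable at t and setting Y′ to 1 gives a line on which D is constantly e.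
module Submission where

open import Data.Bool.Base using (Bool; true; false; not; _∧_; _∨_)
open import Data.Bool.Properties using (_≟_; ¬-not; not-¬; not-injective)
open import Data.Empty using () renaming (⊥ to Empty)
open import Data.Fin.Base as Fin using (Fin; zero; suc; toℕ; _↑ˡ_; _↑ʳ_; splitAt)
open import Data.Fin.Properties
  using (toℕ<n; toℕ-injective; toℕ-↑ˡ; toℕ-↑ʳ; splitAt-≥; splitAt⁻¹-↑ˡ; splitAt⁻¹-↑ʳ;
         toℕ-fromℕ<)
open import Data.Fin.Subset using (Subset; ∁; _∩_; _∪_; ⊥; ⊤)
open import Data.Fin.Subset.Properties
  using (anySubset?; ∩-identityˡ; ∩-zeroʳ; ∪-identityˡ; ∪-identityʳ)
open import Data.List.Base as List using (List; []; _∷_; length; take; applyUpTo)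
open import Data.List.Properties using (length-applyUpTo)
open import Data.Nat.Base using (ℕ; zero; suc; _+_; _≤_; _<_; z≤n; s≤s; s≤s⁻¹)
open import Data.Nat.ListAction using (sum)
open import Data.Nat.Properties
  using (≤-trans; ≤-reflexive; ≤-antisym; <⇒≤; m≤m+n; +-monoʳ-≤; +-monoʳ-<;
         +-cancelˡ-≤; +-cancelˡ-<; +-assoc; module ≤-Reasoning)
open import Data.Product.Base using (_×_; _,_; ∃; ∃-syntax; proj₁; proj₂)
open import Data.Sum.Base using (_⊎_; inj₁; inj₂; [_,_]′)
open import Data.Unit.Base using (tt) renaming (⊤ to Unit)
open import Data.Vec.Base using (Vec; []; _∷_; _++_; map; zipWith; lookup; tabulate)
open import Data.Vec.Properties
  using (map-++; map-∘; map-cong; map-const; map-id; map-replicate; lookup-map; lookup-++ˡ;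
         lookup-++ʳ; zipWith-++; zipWith-map₁; tabulate-∘; tabulate∘lookup; tabulate-cong;
         lookup∘tabulate)
open import Function.Base using (_∘_; id)
open import Function.Bundles using (_⇔_; mk⇔; Equivalence)
open import Relation.Binary.PropositionalEquality
  using (_≡_; _≢_; refl; sym; trans; cong; cong₂; subst; subst₂; module ≡-Reasoning)
open import Relation.Nullary.Decidable using (Dec; yes; no; decidable-stable; _×-dec_; ¬?)
open import Relation.Nullary.Negation using (¬_; contradiction)
open import Relation.Unary using (_∉_)
open import Defs

-- Templates and colourings without monochromatic lines.

-- A section of size `n` that holds the first occurrences of `n` variables carries them in order, so
-- only the letters after it remain to be chosen.
Template : ℕ → ℕ → Set
Template n = Vec (Bool ⊎ Fin n)

infixl 20 _[_]

_[_] : ∀ {n N} → Template n N → Vec Bool n → Vec Bool N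
τ [ a ] = map [ id , lookup a ]′ τ

-- Failure of homogeneity in positive form: each template yields a word of a prescribed colour.
-- Absorbing the constants `u` into the colouring turns every section into a first one.
Bichromatic : (ns : List ℕ) → (Vec Bool (sum ns) → Bool) → Set
Bichromatic []       f = Unit
Bichromatic (n ∷ ns) f =
  (∀ (τ : Template n (sum ns)) b → ∃[ a ] f (a ++ τ [ a ]) ≡ b) ×
  (∀ u → Bichromatic ns (f ∘ (u ++_)))

-- Names 0, 1, ... let a letter be evaluated on its own, without the index found by `occurs-name`.
Standard : ∀ {n N} → VariableWord n N → Set
Standard v = ∀ j → VariableWord.name v j ≡ toℕ j

extend : ∀ {n} → Vec Bool n → ℕ → Bool
-- This default is never read in a standard word, whose variables all have indices below the length
-- of `a`.
extend []      _       = false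
extend (x ∷ a) zero    = x
extend (x ∷ a) (suc k) = extend a k

extend-toℕ : ∀ {n} (a : Vec Bool n) j → extend a (toℕ j) ≡ lookup a j
extend-toℕ (x ∷ a) zero    = refl
extend-toℕ (x ∷ a) (suc j) = extend-toℕ a j

valuation : ∀ {n} → Vec Bool n → Letter → Bool
valuation a (const b) = b
valuation a (var k)   = extend a k

-- The local function by which _⟨_⟩ evaluates letters cannot be named here, so
-- the left-hand side is inferred from the use in ⟨⟩≡map.
⟨⟩-pointwise : ∀ {n N} (v : VariableWord n N) → Standard v → ∀ a t →
               _ ≡ valuation a (lookup (word v) t)

⟨⟩≡map : ∀ {n N} (v : VariableWord n N) → Standard v → ∀ a →
         v ⟨ a ⟩ ≡ map (valuation a) (word v)
⟨⟩≡map v std a = begin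
  v ⟨ a ⟩                                          ≡⟨ tabulate-cong (⟨⟩-pointwise v std a) ⟩
  tabulate (valuation a ∘ lookup (word v))         ≡⟨ tabulate-∘ (valuation a) (lookup (word v)) ⟩
  map (valuation a) (tabulate (lookup (word v)))   ≡⟨ cong (map _) (tabulate∘lookup (word v)) ⟩
  map (valuation a) (word v)                       ∎
  where open ≡-Reasoning

⟨⟩-pointwise v std a t
  with lookup (word v) t | (λ {m} → λ eq → VariableWord.occurs-name v {m} (t , eq))
... | const b | _     = refl
... | var m   | index with index refl
...   | j , name≡m = trans (sym (extend-toℕ a j)) (cong (extend a) (trans (sym (std j)) name≡m))

-- Realising templates as variable words.

Line : (ns : List ℕ) → (Vec Bool (sum ns) → Bool) → Set
Line ns f =
  ∃[ s ] ∃ λ (v : VariableWord (List.lookup ns s) (sum ns)) → Standard v ×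
    (∀ t → (∃[ m ] FirstOccurrence (word v) m t) ⇔ Section ns s (toℕ t)) ×
    (∀ a b → f (v ⟨ a ⟩) ≡ f (v ⟨ b ⟩))

Line⇒SectionallyHomogeneous : ∀ ns f → Line ns f → SectionallyHomogeneous ns f
Line⇒SectionallyHomogeneous _ _ (s , v , _ , first , constant) = s , v , first , constant

module HeadLine {n N} (τ : Template n N) where

  letter : Bool ⊎ Fin n → Letter
  letter = [ const , var ∘ toℕ ]′

  w : Vec Letter (n + N)
  w = tabulate (var ∘ toℕ) ++ map letter τ

  lookup-head : ∀ j → lookup w (j ↑ˡ N) ≡ var (toℕ j)
  lookup-head j = trans (lookup-++ˡ (tabulate (var ∘ toℕ)) _ j) (lookup∘tabulate (var ∘ toℕ) j)

  lookup-tail : ∀ i → lookup w (n ↑ʳ i) ≡ letter (lookup τ i)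
  lookup-tail i = trans (lookup-++ʳ (tabulate {n = n} (var ∘ toℕ)) _ i) (lookup-map i letter τ)

  letter-var : ∀ ℓ {k} → letter ℓ ≡ var k → ∃ λ (j : Fin n) → toℕ j ≡ k
  letter-var (inj₂ j) refl = j , refl

  -- Within the section, variable `k` stands at position `k`; the later positions exceed every
  -- index. The bound makes position `k` the first occurrence.
  occurrence : ∀ {t k} → lookup w t ≡ var k → (∃ λ (j : Fin n) → toℕ j ≡ k) × k ≤ toℕ t
  occurrence {t} {k} eq with splitAt n t in split
  ... | inj₁ i with refl ← splitAt⁻¹-↑ˡ {i = t} split
               with refl ← trans (sym (lookup-head i)) eq =
    (i , refl) , ≤-reflexive (sym (toℕ-↑ˡ i N))
  ... | inj₂ i with refl ← splitAt⁻¹-↑ʳ {i = t} split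
    with letter-var (lookup τ i) (trans (sym (lookup-tail i)) eq)
  ...   | j , refl = (j , refl) , (begin
    toℕ j         ≤⟨ <⇒≤ (toℕ<n j) ⟩
    n             ≤⟨ m≤m+n n (toℕ i) ⟩
    n + toℕ i     ≡⟨ toℕ-↑ʳ n i ⟨
    toℕ (n ↑ʳ i)  ∎)
    where open ≤-Reasoning

  first⇒≡ : ∀ {t k} → FirstOccurrence w k t → toℕ t ≡ k × k < n
  first⇒≡ {t} (eq , least) with occurrence eq
  ... | (j , refl) , j≤t =
    ≤-antisym (≤-trans (least (j ↑ˡ N) (lookup-head j)) (≤-reflexive (toℕ-↑ˡ j N))) j≤t , toℕ<n j

  headWord : VariableWord n (n + N)
  headWord = record
    { word             = w
    ; name             = toℕ
    ; name-increasing  = id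
    ; name-occurs      = λ j → j ↑ˡ N , lookup-head j
    ; occurs-name      = λ (t , eq) → proj₁ (occurrence eq)
    ; first-increasing = λ {m} {m′} {t} {t′} first first′ m<m′ →
        subst₂ _<_ (sym (proj₁ (first⇒≡ {t} first))) (sym (proj₁ (first⇒≡ {t′} first′))) m<m′
    }

  first-head : ∀ t → (∃[ m ] FirstOccurrence w m t) ⇔ (0 ≤ toℕ t × toℕ t < n)
  first-head t = mk⇔
    (λ (m , first) → let t≡m , m<n = first⇒≡ {t} first in z≤n , subst (_< n) (sym t≡m) m<n)
    λ (_ , t<n) → toℕ t , lookup-t t<n , λ t′ eq → proj₂ (occurrence {t′} eq)
    where
    lookup-t : toℕ t < n → lookup w t ≡ var (toℕ t)
    lookup-t t<n = subst (λ i → lookup w i ≡ var (toℕ t)) t≡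
                     (trans (lookup-head (Fin.fromℕ< t<n)) (cong var (toℕ-fromℕ< t<n)))
      where
      t≡ : Fin.fromℕ< t<n ↑ˡ N ≡ t
      t≡ = toℕ-injective (trans (toℕ-↑ˡ _ N) (toℕ-fromℕ< t<n))

  headWord⟨⟩ : ∀ a → headWord ⟨ a ⟩ ≡ a ++ τ [ a ]
  headWord⟨⟩ a = begin
    headWord ⟨ a ⟩                                           ≡⟨ ⟨⟩≡map headWord (λ _ → refl) a ⟩
    map V w                                                  ≡⟨ map-++ V _ (map letter τ) ⟩
    map V (tabulate (var ∘ toℕ)) ++ map V (map letter τ)     ≡⟨ cong₂ _++_ head tail ⟩
    a ++ τ [ a ]                                             ∎
    where
    open ≡-Reasoning
    V = valuation a

    head : map V (tabulate (var ∘ toℕ)) ≡ a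
    head = trans (sym (tabulate-∘ V (var ∘ toℕ)))
                 (trans (tabulate-cong (extend-toℕ a)) (tabulate∘lookup a))

    V-letter : ∀ ℓ → V (letter ℓ) ≡ [ id , lookup a ]′ ℓ
    V-letter (inj₁ b) = refl
    V-letter (inj₂ j) = extend-toℕ a j

    tail : map V (map letter τ) ≡ τ [ a ]
    tail = trans (sym (map-∘ V letter τ)) (map-cong V-letter τ)

module ShiftedLine {m n N} (u : Vec Bool m) (v : VariableWord n N) where
  open VariableWord v using (name; name-increasing; name-occurs; occurs-name; first-increasing)

  w : Vec Letter (m + N)
  w = map const u ++ word v

  lookup-shift : ∀ t → lookup w (m ↑ʳ t) ≡ lookup (word v) t
  lookup-shift = lookup-++ʳ (map const u) (word v)

  occurrence : ∀ {t k} → lookup w t ≡ var k → ∃[ t′ ] m ↑ʳ t′ ≡ t × lookup (word v) t′ ≡ var k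
  occurrence {t} eq with splitAt m t in split
  ... | inj₁ i with refl ← splitAt⁻¹-↑ˡ {i = t} split
    with () ← trans (sym (trans (lookup-++ˡ (map const u) (word v) i) (lookup-map i const u))) eq
  ... | inj₂ i with refl ← splitAt⁻¹-↑ʳ {i = t} split = i , refl , trans (sym (lookup-shift i)) eq

  ↑ʳ-cancel-≤ : ∀ {i j : Fin N} → m ↑ʳ i Fin.≤ m ↑ʳ j → i Fin.≤ j
  ↑ʳ-cancel-≤ {i} {j} le = +-cancelˡ-≤ m _ _ (subst₂ _≤_ (toℕ-↑ʳ m i) (toℕ-↑ʳ m j) le)

  ↑ʳ-mono-≤ : ∀ {i j : Fin N} → i Fin.≤ j → m ↑ʳ i Fin.≤ m ↑ʳ j
  ↑ʳ-mono-≤ {i} {j} le = subst₂ _≤_ (sym (toℕ-↑ʳ m i)) (sym (toℕ-↑ʳ m j)) (+-monoʳ-≤ m le)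

  first⇒ : ∀ {t k} → FirstOccurrence w k t → ∃[ t′ ] m ↑ʳ t′ ≡ t × FirstOccurrence (word v) k t′
  first⇒ (eq , least) with occurrence eq
  ... | t′ , refl , eq′ =
    t′ , refl , eq′ , λ i eqᵢ → ↑ʳ-cancel-≤ {t′} {i} (least (m ↑ʳ i) (trans (lookup-shift i) eqᵢ))

  first⇐ : ∀ {t k} → FirstOccurrence (word v) k t → FirstOccurrence w k (m ↑ʳ t)
  first⇐ {t} (eq , least) = trans (lookup-shift t) eq , bound
    where
    bound : ∀ i → lookup w i ≡ var _ → m ↑ʳ t Fin.≤ i
    bound i eqᵢ with occurrence {i} eqᵢ
    ... | i′ , refl , eqᵢ′ = ↑ʳ-mono-≤ {t} {i′} (least i′ eqᵢ′)

  shiftedWord : VariableWord n (m + N)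
  shiftedWord = record
    { word             = w
    ; name             = name
    ; name-increasing  = name-increasing
    ; name-occurs      = λ j → m ↑ʳ proj₁ (name-occurs j) ,
                               trans (lookup-shift _) (proj₂ (name-occurs j))
    ; occurs-name      = λ (t , eq) → let t′ , _ , eq′ = occurrence eq in occurs-name (t′ , eq′)
    ; first-increasing = increasing
    }
    where
    increasing : ∀ {k k′ t t′} → FirstOccurrence w k t → FirstOccurrence w k′ t′ →
                 k < k′ → t Fin.< t′
    increasing first first′ k<k′ with first⇒ first | first⇒ first′
    ... | i , refl , firstᵢ | i′ , refl , firstᵢ′ =
      subst₂ _<_ (sym (toℕ-↑ʳ m i)) (sym (toℕ-↑ʳ m i′))
        (+-monoʳ-< m (first-increasing firstᵢ firstᵢ′ k<k′))

  shiftedWord⟨⟩ : Standard v → ∀ a → shiftedWord ⟨ a ⟩ ≡ u ++ v ⟨ a ⟩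
  shiftedWord⟨⟩ std a = begin
    shiftedWord ⟨ a ⟩                       ≡⟨ ⟨⟩≡map shiftedWord std a ⟩
    map V w                                 ≡⟨ map-++ V (map const u) (word v) ⟩
    map V (map const u) ++ map V (word v)   ≡⟨ cong₂ _++_ (trans (sym (map-∘ V const u)) (map-id u))
                                                          (sym (⟨⟩≡map v std a)) ⟩
    u ++ v ⟨ a ⟩                            ∎
    where
    open ≡-Reasoning
    V = valuation a

line-head : ∀ {n ns} f (τ : Template n (sum ns)) →
            (∀ a b → f (a ++ τ [ a ]) ≡ f (b ++ τ [ b ])) → Line (n ∷ ns) f
line-head f τ constant = zero , headWord , (λ _ → refl) , first-head , λ a b →
  trans (cong f (headWord⟨⟩ a)) (trans (constant a b) (cong f (sym (headWord⟨⟩ b))))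
  where open HeadLine τ

line-shift : ∀ {m ns} f (u : Vec Bool m) → Line ns (f ∘ (u ++_)) → Line (m ∷ ns) f
line-shift {m} {ns} f u (s , v , std , first , constant) =
  suc s , shiftedWord , std , first′ , λ a b →
    trans (cong f (shiftedWord⟨⟩ std a)) (trans (constant a b) (cong f (sym (shiftedWord⟨⟩ std b))))
  where
  open ShiftedLine u v
  start = sum (take (toℕ s) ns)

  first′ : ∀ t → (∃[ k ] FirstOccurrence w k t) ⇔ Section (m ∷ ns) (suc s) (toℕ t)
  first′ t = mk⇔ to from
    where
    to : ∃[ k ] FirstOccurrence w k t → Section (m ∷ ns) (suc s) (toℕ t)
    to (k , firstₜ) with first⇒ {t} firstₜ
    ... | i , refl , firstᵢ =
      let low , high = Equivalence.to (first i) (k , firstᵢ) in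
      subst (m + start ≤_) (sym (toℕ-↑ʳ m i)) (+-monoʳ-≤ m low) ,
      subst₂ _<_ (sym (toℕ-↑ʳ m i)) (sym (+-assoc m start _)) (+-monoʳ-< m high)

    from : Section (m ∷ ns) (suc s) (toℕ t) → ∃[ k ] FirstOccurrence w k t
    from (low , high) with splitAt⁻¹-↑ʳ {m} {i = t} (splitAt-≥ m t (≤-trans (m≤m+n m start) low))
    ... | ↑ʳi≡t = let k , firstᵢ = Equivalence.from (first i) (low′ , high′) in
                  k , subst (FirstOccurrence w k) ↑ʳi≡t (first⇐ firstᵢ)
      where
      i = Fin.reduce≥ t (≤-trans (m≤m+n m start) low)
      t≡m+i = trans (cong toℕ (sym ↑ʳi≡t)) (toℕ-↑ʳ m i)
      low′ = +-cancelˡ-≤ m _ _ (subst (m + start ≤_) t≡m+i low)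
      high′ = +-cancelˡ-< m _ _ (subst₂ _<_ t≡m+i (+-assoc m start _) high)

-- A colour missed along a template leaves a single colour for the whole line. A finite search
-- decides whether it is missed.
bichromatic : ∀ ns f → ¬ Line ns f → Bichromatic ns f
bichromatic []       f ¬line = tt
bichromatic (n ∷ ns) f ¬line =
  (λ τ b → decidable-stable (anySubset? (λ a → f (a ++ τ [ a ]) ≟ b)) λ ¬∃ →
    let avoids a = ¬-not (λ eq → ¬∃ (a , eq)) in
    ¬line (line-head f τ λ a a′ → trans (avoids a) (sym (avoids a′)))) ,
  λ u → bichromatic ns (f ∘ (u ++_)) (¬line ∘ line-shift f u)

-- Coincidence of two colourings in both colours.

∁∁∩ : ∀ {n} (M Y P : Subset n) → ∁ (∁ M ∩ Y) ∩ (M ∩ P) ≡ M ∩ P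
∁∁∩ [] [] [] = refl
∁∁∩ (true ∷ M)  (y ∷ Y)     (p ∷ P) = cong (p ∷_) (∁∁∩ M Y P)
∁∁∩ (false ∷ M) (true ∷ Y)  (p ∷ P) = cong (false ∷_) (∁∁∩ M Y P)
∁∁∩ (false ∷ M) (false ∷ Y) (p ∷ P) = cong (false ∷_) (∁∁∩ M Y P)

∁∁∩-self : ∀ {n} (M W : Subset n) → ∁ (∁ M ∩ W) ∩ W ≡ M ∩ W
∁∁∩-self [] [] = refl
∁∁∩-self (true ∷ M)  (w ∷ W)     = cong (w ∷_) (∁∁∩-self M W)
∁∁∩-self (false ∷ M) (true ∷ W)  = cong (false ∷_) (∁∁∩-self M W)
∁∁∩-self (false ∷ M) (false ∷ W) = cong (false ∷_) (∁∁∩-self M W)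

∁∩∪-self : ∀ {n} (M W : Subset n) → (∁ M ∩ W) ∪ W ≡ W
∁∩∪-self [] [] = refl
∁∩∪-self (true ∷ M)  (w ∷ W)     = cong (w ∷_) (∁∩∪-self M W)
∁∩∪-self (false ∷ M) (true ∷ W)  = cong (true ∷_) (∁∩∪-self M W)
∁∩∪-self (false ∷ M) (false ∷ W) = cong (false ∷_) (∁∩∪-self M W)

-- The colour missed by Y is c Y; P is replaced by P ∖ Y so that no disjointness is assumed.
Separated : ∀ {n} {Z : Set} (F G : Subset n → Z → Bool) (c : Subset n → Bool) → Set
Separated F G c = ∀ P Y z → F (∁ Y ∩ P) z ≡ c Y → G (Y ∪ P) z ≢ c Y

-- ∁ M is a maximal set all of whose subsets have the colour of ∅. If t ∈ M and S ⊆ ∁ M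
-- satisfies c (S ∪ {t}) ≠ c S, then removing t from a set disjoint from S cannot destroy
-- the colour c ⊥ of F, since G takes on P ∪ {t} ∪ S a colour other than c ⊥.
maximal : ∀ {n} {Z : Set} (F G : Subset n → Z → Bool) c → Separated F G c →
          ∃[ M ] (∀ Y → c (∁ M ∩ Y) ≡ c ⊥) × (∀ P z → F M z ≡ c ⊥ → F (M ∩ P) z ≡ c ⊥)
maximal {zero}          F G c sep = [] , (λ { [] → refl }) , λ { [] z → id }
maximal {suc n} {Z} F G c sep = extendBy (anySubset? λ Y → ¬? (c (true ∷ (∁ M ∩ Y)) ≟ c ⊥))
  where
  -- The bit of the first position joins the parameter `z`, so one `M` serves sets with and without
  -- that position.
  IH : ∃[ M ] (∀ Y → c (false ∷ (∁ M ∩ Y)) ≡ c ⊥) ×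
       (∀ P (z : Bool × Z) →
         F (proj₁ z ∷ M) (proj₂ z) ≡ c ⊥ → F (proj₁ z ∷ (M ∩ P)) (proj₂ z) ≡ c ⊥)
  IH = maximal (λ P (b , z) → F (b ∷ P) z) (λ P (b , z) → G (b ∷ P) z) (c ∘ (false ∷_))
               λ P Y (b , z) → sep (b ∷ P) (false ∷ Y) z
  M = proj₁ IH
  c-const = proj₁ (proj₂ IH)
  F-down : ∀ P b z → F (b ∷ M) z ≡ c ⊥ → F (b ∷ (M ∩ P)) z ≡ c ⊥
  F-down P b z = proj₂ (proj₂ IH) P (b , z)

  extendBy : Dec (∃[ Y ] c (true ∷ (∁ M ∩ Y)) ≢ c ⊥) → _
  extendBy (no ¬∃) = false ∷ M ,
    (λ { (false ∷ Y) → c-const Y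
       ; (true ∷ Y) → decidable-stable (_ ≟ _) λ ne → ¬∃ (Y , ne) }) ,
    λ { (_ ∷ P) z → F-down P false z }
  extendBy (yes (Y , ne)) = true ∷ M , (λ { (_ ∷ Y) → c-const Y }) , down
    where
    down : ∀ P z → F (true ∷ M) z ≡ c ⊥ → F ((true ∷ M) ∩ P) z ≡ c ⊥
    down (true ∷ P)  z eq = F-down P true z eq
    down (false ∷ P) z eq = decidable-stable (_ ≟ _) λ neF →
      sep (true ∷ Q) (false ∷ S) z
        (trans (cong (λ R → F (true ∷ R) z) ∁S∩Q≡Q) (trans (F-down P true z eq) (sym (c-const Y))))
        (decidable-stable (_ ≟ _) λ neG →
      sep (false ∷ Q) (true ∷ S) z
        (trans (cong (λ R → F (false ∷ R) z) ∁S∩Q≡Q) (trans (¬-not neF) (sym (¬-not ne))))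
        (trans (¬-not neG) (trans (cong not (c-const Y)) (sym (¬-not ne)))))
      where
      S = ∁ M ∩ Y
      Q = M ∩ P
      ∁S∩Q≡Q = ∁∁∩ M Y P

-- Split `W` along `M`: the part outside has colour `c ⊥` under `c`, and `F` keeps this colour on
-- the part inside. Separation at these two parts then bars `G` from it at their union `W`.
dominated : ∀ {n} {Z : Set} (F G : Subset n → Z → Bool) c → Separated F G c →
            ∃[ M ] ∃[ e ] (∀ z → F M z ≡ e → ∀ W → G W z ≢ e)
dominated F G c sep with maximal F G c sep
... | M , c-const , F-down = M , c ⊥ , λ z eq W eqG →
  sep W (∁ M ∩ W) z
    (trans (cong (λ R → F R z) (∁∁∩-self M W)) (trans (F-down W z eq) (sym (c-const W))))
    (trans (cong (λ R → G R z) (∁∩∪-self M W)) (trans eqG (sym (c-const W))))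

constant-[] : ∀ {n N} (z : Vec Bool N) (a : Vec Bool n) → map inj₁ z [ a ] ≡ z
constant-[] z a = trans (sym (map-∘ [ id , lookup a ]′ inj₁ z)) (map-id z)

Coincide : ∀ {m k N} (A B : Vec Bool (m + (k + N)) → Bool) → Subset m → Bool → Set
Coincide {k = k} A B Y b =
  ∃[ P ] ∃ λ (z : Vec Bool k) → A ((∁ Y ∩ P) ++ (z ++ ⊥)) ≡ b × B ((Y ∪ P) ++ (z ++ ⊥)) ≡ b

-- Otherwise every `Y` misses a colour and `dominated` applies. The second section supplies `z`
-- giving A the colour `e` over `M`; with `z` fixed, B then avoids `e` on a line of the first
-- section.
coincidence : ∀ m k ns {A B} → Bichromatic (m ∷ k ∷ ns) A → Bichromatic (m ∷ k ∷ ns) B →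
              ∃[ Y ] ∀ b → Coincide {m} {k} {sum ns} A B Y b
coincidence m k ns {A} {B} biA biB =
  conclude (anySubset? λ Y → coincide? Y true ×-dec coincide? Y false)
  where
  Coincides = Coincide {m} {k} {sum ns} A B

  coincide? : ∀ Y b → Dec (Coincides Y b)
  coincide? Y b = anySubset? λ P → anySubset? λ z → (_ ≟ b) ×-dec (_ ≟ b)

  conclude : Dec (∃[ Y ] Coincides Y true × Coincides Y false) → ∃[ Y ] ∀ b → Coincides Y b
  conclude (yes (Y , t , f)) = Y , λ { true → t ; false → f }
  conclude (no ¬∃)           = contradiction (proj₁ biB (map inj₁ (z ++ ⊥)) e) λ (W , eq) →
    dom z (trans (cong (λ y → A (M ++ (z ++ y))) (sym (constant-[] ⊥ z))) (proj₂ escape)) W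
      (trans (cong (λ y → B (W ++ y)) (sym (constant-[] (z ++ ⊥) W))) eq)
    where
    missed : ∀ Y → ∃[ b ] ¬ Coincides Y b
    missed Y with coincide? Y true
    ... | yes t = false , λ f → ¬∃ (Y , t , f)
    ... | no ¬t = true , ¬t

    domination = dominated (λ P z → A (P ++ (z ++ ⊥))) (λ P z → B (P ++ (z ++ ⊥))) (proj₁ ∘ missed)
                   λ P Y z eqA eqB → proj₂ (missed Y) (P , z , eqA , eqB)
    M   = proj₁ domination
    e   = proj₁ (proj₂ domination)
    dom = proj₂ (proj₂ domination)

    escape = proj₁ (proj₂ biA M) (map inj₁ ⊥) e
    z = proj₁ escape

-- Four colourings after the section of size 2.

zipWith-[] : ∀ {n N} {h : Bool → Bool → Bool ⊎ Fin n} {k} a →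
             (∀ x y → [ id , lookup a ]′ (h x y) ≡ k x y) →
             ∀ (X Y : Vec Bool N) → zipWith h X Y [ a ] ≡ zipWith k X Y
zipWith-[] a h≡k []      []      = refl
zipWith-[] a h≡k (x ∷ X) (y ∷ Y) = cong₂ _∷_ (h≡k x y) (zipWith-[] a h≡k X Y)

map-[] : ∀ {n N} {h : Bool → Bool ⊎ Fin n} {k} a → (∀ x → [ id , lookup a ]′ (h x) ≡ k x) →
         ∀ (X : Vec Bool N) → map h X [ a ] ≡ map k X
map-[] a h≡k X = trans (sym (map-∘ _ _ X)) (map-cong h≡k X)

zipWith-ignoreʳ : ∀ {n} (g : Bool → Bool) (X Y : Vec Bool n) → zipWith (λ x _ → g x) X Y ≡ map g X
zipWith-ignoreʳ g []      []      = refl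
zipWith-ignoreʳ g (x ∷ X) (y ∷ Y) = cong (g x ∷_) (zipWith-ignoreʳ g X Y)

++-[] : ∀ {n M N} (σ : Template n M) (τ : Template n N) {x y} a →
        σ [ a ] ≡ x → τ [ a ] ≡ y → (σ ++ τ) [ a ] ≡ x ++ y
++-[] σ τ a eqσ eqτ = trans (map-++ _ σ τ) (cong₂ _++_ eqσ eqτ)

pattern 𝕩 = inj₂ zero
pattern 𝕪 = inj₂ (suc zero)

infix 30 _⟪_,_⟫

_⟪_,_⟫ : ∀ {N} → Template 2 N → Bool → Bool → Vec Bool N
τ ⟪ a , b ⟫ = τ [ a ∷ b ∷ [] ]

Colouring : ℕ → Set
Colouring N = Vec Bool N → Bool

-- The letters 1, `𝕩`, `𝕪` of `τ` occupy disjoint sets P, X, Y, and the four arguments are P, P ∪ Y,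
-- P ∪ X, P ∪ X ∪ Y.
record Avoiding {N} (A B C D : Colouring N) : Set where
  constructor avoids
  field
    avoid : ∀ (τ : Template 2 N) b →
      A (τ ⟪ false , false ⟫) ≡ b → B (τ ⟪ false , true ⟫) ≡ b →
      C (τ ⟪ true , false ⟫) ≡ b → D (τ ⟪ true , true ⟫) ≡ b → Empty

avoiding-swap : ∀ {N} {A B C D : Colouring N} → Avoiding A B C D → Avoiding A C B D
avoiding-swap {A = A} {B} {C} {D} (avoids avoid) =
  avoids λ τ b eqA eqC eqB eqD → avoid (map swap τ) b
    (trans (cong A (swapped τ false false)) eqA) (trans (cong B (swapped τ false true)) eqB)
    (trans (cong C (swapped τ true false)) eqC) (trans (cong D (swapped τ true true)) eqD)
  where
  swap : Bool ⊎ Fin 2 → Bool ⊎ Fin 2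
  swap (inj₁ c) = inj₁ c
  swap 𝕩 = 𝕪
  swap 𝕪 = 𝕩

  swapped : ∀ τ x y → map swap τ ⟪ x , y ⟫ ≡ τ ⟪ y , x ⟫
  swapped τ x y = trans (sym (map-∘ [ id , lookup (x ∷ y ∷ []) ]′ swap τ))
                        (map-cong (λ { (inj₁ c) → refl ; 𝕩 → refl ; 𝕪 → refl }) τ)

-- If C and D agreed, A and B could be made to coincide in the same colour. `P` and `z` depend on
-- that colour, but `𝕩` fills the remaining zeros outside `Y` and in `z`; when it is 1, both traces
-- vanish from C and D. Hence `K` is the same for all `Z`.
opposition : ∀ m k ns {A B C D} → Bichromatic (m ∷ k ∷ ns) A → Bichromatic (m ∷ k ∷ ns) B →
             Avoiding A B C D →
             ∃[ K ] ∀ Z → D (⊤ {m} ++ (⊤ {k} ++ Z)) ≡ not (C (K ++ (⊤ {k} ++ Z)))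
opposition m k ns {A} {B} {C} {D} biA biB (avoids avoid) with coincidence m k ns {A} {B} biA biB
... | Y , coincide = ∁ Y , λ Z → ¬-not (differ Z)
  where
  σ₁ : Bool → Bool → Bool ⊎ Fin 2
  σ₁ true  _     = 𝕪
  σ₁ false true  = inj₁ true
  σ₁ false false = 𝕩
  σ₂ : Bool → Bool ⊎ Fin 2
  σ₂ = σ₁ false
  σ₃ : Bool → Bool ⊎ Fin 2
  σ₃ true  = 𝕩
  σ₃ false = inj₁ false

  σ₂-id : ∀ {N} (z : Vec Bool N) b → map σ₂ z ⟪ false , b ⟫ ≡ z
  σ₂-id z b = trans (map-[] (false ∷ b ∷ []) (λ { true → refl ; false → refl }) z) (map-id z)
  σ₂-⊤ : ∀ {N} (z : Vec Bool N) b → map σ₂ z ⟪ true , b ⟫ ≡ ⊤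
  σ₂-⊤ z b = trans (map-[] (true ∷ b ∷ []) (λ { true → refl ; false → refl }) z) (map-const z true)
  σ₃-⊥ : ∀ {N} (Z : Vec Bool N) b → map σ₃ Z ⟪ false , b ⟫ ≡ ⊥
  σ₃-⊥ Z b =
    trans (map-[] (false ∷ b ∷ []) (λ { true → refl ; false → refl }) Z) (map-const Z false)
  σ₃-id : ∀ {N} (Z : Vec Bool N) b → map σ₃ Z ⟪ true , b ⟫ ≡ Z
  σ₃-id Z b = trans (map-[] (true ∷ b ∷ []) (λ { true → refl ; false → refl }) Z) (map-id Z)

  σ₁-table : ∀ {N} (P : Vec Bool N) a b k →
             (∀ y p → [ id , lookup (a ∷ b ∷ []) ]′ (σ₁ y p) ≡ k y p) →
             ∀ Y → zipWith σ₁ Y P ⟪ a , b ⟫ ≡ zipWith k Y P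
  σ₁-table P a b k table Y = zipWith-[] (a ∷ b ∷ []) table Y P

  differ : ∀ Z → D (⊤ {m} ++ (⊤ {k} ++ Z)) ≢ C (∁ Y ++ (⊤ ++ Z))
  differ Z D≡C with coincide (C (∁ Y ++ (⊤ ++ Z)))
  ... | P , z , eqA , eqB = avoid (zipWith σ₁ Y P ++ (map σ₂ z ++ map σ₃ Z)) _
    (trans (cong A (at false false
      (trans (σ₁-table P false false (λ y p → not y ∧ p)
               (λ { true _ → refl ; false true → refl ; false false → refl }) Y)
             (sym (zipWith-map₁ _∧_ not Y P)))
      (σ₂-id z false) (σ₃-⊥ Z false))) eqA)
    (trans (cong B (at false true
      (σ₁-table P false true _∨_ (λ { true _ → refl ; false true → refl ; false false → refl }) Y)
      (σ₂-id z true) (σ₃-⊥ Z true))) eqB)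
    (cong C (at true false
      (trans (σ₁-table P true false (λ y _ → not y)
               (λ { true _ → refl ; false true → refl ; false false → refl }) Y)
             (zipWith-ignoreʳ not Y P))
      (σ₂-⊤ z false) (σ₃-id Z false)))
    (trans (cong D (at true true
      (trans (σ₁-table P true true (λ _ _ → true)
               (λ { true _ → refl ; false true → refl ; false false → refl }) Y)
             (trans (zipWith-ignoreʳ (λ _ → true) Y P) (map-const Y true)))
      (σ₂-⊤ z true) (σ₃-id Z true))) D≡C)
    where
    at : ∀ a b {x y v} →
         zipWith σ₁ Y P ⟪ a , b ⟫ ≡ x → map σ₂ z ⟪ a , b ⟫ ≡ y → map σ₃ Z ⟪ a , b ⟫ ≡ v →
         (zipWith σ₁ Y P ++ (map σ₂ z ++ map σ₃ Z)) ⟪ a , b ⟫ ≡ x ++ (y ++ v)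
    at a b eq₁ eq₂ eq₃ = ++-[] (zipWith σ₁ Y P) _ (a ∷ b ∷ []) eq₁
                           (++-[] (map σ₂ z) (map σ₃ Z) (a ∷ b ∷ []) eq₂ eq₃)

fixing : ∀ {m k N} → Subset m → Colouring (m + (k + N)) → Colouring N
fixing U f Z = f (U ++ (⊤ ++ Z))

-- The complement of `K` follows `𝕪`: A and C, where `𝕪` is 0, see `K`, while B and D see the full
-- section. This matches the words compared in `opposition`.
avoiding-fixing : ∀ {m k N} {A B C D : Colouring (m + (k + N))} (K : Subset m) →
                  Avoiding A B C D →
                  Avoiding (fixing {m} {k} K A) (fixing {m} {k} ⊤ B)
                           (fixing {m} {k} K C) (fixing {m} {k} ⊤ D)
avoiding-fixing {m} {k} {N} {A} {B} {C} {D} K (avoids avoid) =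
  avoids λ τ b eqA eqB eqC eqD → avoid (τ′ τ) b
    (trans (cong A (at τ false false (σ-id false))) eqA)
    (trans (cong B (at τ false true (σ-⊤ false))) eqB)
    (trans (cong C (at τ true false (σ-id true))) eqC)
    (trans (cong D (at τ true true (σ-⊤ true))) eqD)
  where
  σ : Bool → Bool ⊎ Fin 2
  σ true  = inj₁ true
  σ false = 𝕪
  τ′ : Template 2 N → Template 2 (m + (k + N))
  τ′ τ = map σ K ++ (map inj₁ (⊤ {k}) ++ τ)

  σ-id : ∀ a → map σ K ⟪ a , false ⟫ ≡ K
  σ-id a = trans (map-[] (a ∷ false ∷ []) (λ { true → refl ; false → refl }) K) (map-id K)
  σ-⊤ : ∀ a → map σ K ⟪ a , true ⟫ ≡ ⊤
  σ-⊤ a = trans (map-[] (a ∷ true ∷ []) (λ { true → refl ; false → refl }) K) (map-const K true)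

  at : ∀ τ a b {x} → map σ K ⟪ a , b ⟫ ≡ x → τ′ τ ⟪ a , b ⟫ ≡ x ++ (⊤ ++ τ ⟪ a , b ⟫)
  at τ a b eq = ++-[] (map σ K) _ (a ∷ b ∷ []) eq
                (++-[] (map inj₁ (⊤ {k})) τ (a ∷ b ∷ []) (constant-[] ⊤ (a ∷ b ∷ [])) refl)

-- Colours closed under disjoint unions.

-- Removing the first set from the second replaces a disjointness hypothesis.
Closed : ∀ {m N} → (Subset m → Subset N → Bool) → Bool → Set
Closed h e = ∀ X Y X′ Y′ → h X Y ≡ e → h (∁ X ∩ X′) (∁ Y ∩ Y′) ≡ e → h (X ∪ X′) (Y ∪ Y′) ≡ e

∁⊥∩ : ∀ {n} (X : Subset n) → ∁ ⊥ ∩ X ≡ X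
∁⊥∩ {n} X = trans (cong (_∩ X) (map-replicate not false n)) (∩-identityˡ X)

∁∩-++ : ∀ {m n} (X X′ : Subset m) (Y Y′ : Subset n) →
        ∁ (X ++ Y) ∩ (X′ ++ Y′) ≡ (∁ X ∩ X′) ++ (∁ Y ∩ Y′)
∁∩-++ X X′ Y Y′ = trans (cong (_∩ (X′ ++ Y′)) (map-++ not X Y)) (zipWith-++ _∧_ (∁ X) (∁ Y) X′ Y′)

closed-∷ : ∀ {m k N} (h : Subset (suc m) → Subset (k + N) → Bool) {e} → Closed h e →
           Closed {m} {N} (λ X Y → h (false ∷ X) (⊥ ++ Y)) e
closed-∷ h closed X Y X′ Y′ eq eq′ = trans
  (cong (h _) (sym (trans (zipWith-++ _∨_ ⊥ Y ⊥ Y′) (cong (_++ (Y ∪ Y′)) (∪-identityˡ ⊥)))))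
  (closed (false ∷ X) (⊥ ++ Y) (false ∷ X′) (⊥ ++ Y′) eq
    (trans (cong (h _) (trans (∁∩-++ ⊥ ⊥ Y Y′) (cong (_++ (∁ Y ∩ Y′)) (∁⊥∩ ⊥)))) eq′))

-- The first bit of a word of Subset m gets its own section k, left empty by the other bits.
captured : ∀ m ks → m < length ks → (h : Subset m → Subset (sum ks) → Bool) (e : Bool) →
           (∀ X → Bichromatic ks (h X)) → Closed h e →
           ∃ λ (τ : Template m (sum ks)) → ∀ W → h W (τ [ W ]) ≡ e
-- With no bits left, one more section supplies a word of colour `e`, the Y′ of the idea. This is
-- why the inequality is strict.
captured zero (k ∷ ks) _ h e bi closed with proj₁ (bi []) (map inj₁ ⊥) e
... | a , eq = map inj₁ (a ++ map inj₁ ⊥ [ a ]) ,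
  λ { [] → trans (cong (h []) (constant-[] (a ++ map inj₁ ⊥ [ a ]) [])) eq }
captured (suc m) (k ∷ ks) m<l h e bi closed
  with captured m ks (s≤s⁻¹ m<l) (λ X Y → h (false ∷ X) (⊥ ++ Y)) e
         (λ X → proj₂ (bi (false ∷ X)) ⊥) (closed-∷ {k = k} h closed)
     | proj₁ (bi (true ∷ ⊥)) (map inj₁ ⊥) e
... | τ , captures | a , eq = map σ a ++ map weaken τ , at
  where
  σ : Bool → Bool ⊎ Fin (suc m)
  σ true  = inj₂ zero
  σ false = inj₁ false

  weaken : Bool ⊎ Fin m → Bool ⊎ Fin (suc m)
  weaken = [ inj₁ , inj₂ ∘ suc ]′

  weaken-[] : ∀ w W → map weaken τ [ w ∷ W ] ≡ τ [ W ]
  weaken-[] w W = trans (sym (map-∘ [ id , lookup (w ∷ W) ]′ weaken τ))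
                        (map-cong (λ { (inj₁ _) → refl ; (inj₂ _) → refl }) τ)

  at : ∀ W → h W ((map σ a ++ map weaken τ) [ W ]) ≡ e
  at (false ∷ W) = trans (cong (h (false ∷ W)) (++-[] (map σ a) _ (false ∷ W)
    (trans (map-[] (false ∷ W) (λ { true → refl ; false → refl }) a) (map-const a false))
    (weaken-[] false W))) (captures W)
  at (true ∷ W) = trans
    (cong₂ h (cong (true ∷_) (sym (∪-identityˡ W)))
      (trans (++-[] (map σ a) _ (true ∷ W)
               (trans (map-[] (true ∷ W) (λ { true → refl ; false → refl }) a) (map-id a))
               (weaken-[] true W))
        (sym (trans (zipWith-++ _∨_ a ⊥ ⊥ (τ [ W ]))
                    (cong₂ _++_ (∪-identityʳ a) (∪-identityˡ (τ [ W ])))))))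
    -- The first bit with its own section and the other bits with theirs are disjoint sets of colour
    -- `e`.
    (closed (true ∷ ⊥) (a ++ ⊥) (false ∷ W) (⊥ ++ τ [ W ])
      (trans (cong (λ y → h (true ∷ ⊥) (a ++ y)) (sym (constant-[] ⊥ a))) eq)
      (trans (cong₂ h (cong (false ∷_) (∁⊥∩ W))
        (trans (∁∩-++ a ⊥ ⊥ (τ [ W ])) (cong₂ _++_ (∩-zeroʳ (∁ a)) (∁⊥∩ (τ [ W ])))))
        (captures W)))

closed-section : ∀ m ks h {e} → m < length ks → Bichromatic (m ∷ ks) h →
                 ¬ Closed {m} {sum ks} (λ X Y → h (X ++ Y)) e
closed-section m ks h {e} m<l (lines , below) closed
  with captured m ks m<l (λ X Y → h (X ++ Y)) e below closed
... | τ , captures with lines τ (not e)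
...   | W , eq = not-¬ (captures W) eq

-- Put `𝕩` on the first set, `𝕪` on the rest of the second and no constant 1. If D has the colour
-- opposite to `A ⊥` on both parts, then C and B have the colour `A ⊥` there, so D cannot take it on
-- the union.
opposite⇒closed : ∀ {m N} {A B C D : Colouring (m + N)} → Avoiding A B C D →
                  (∀ Z → D Z ≡ not (B Z)) → (∀ Z → D Z ≡ not (C Z)) →
                  Closed {m} {N} (λ X Y → D (X ++ Y)) (not (A ⊥))
opposite⇒closed {m} {N} {A} {B} {C} {D} (avoids avoid) D≡¬B D≡¬C X Y X′ Y′ eq eq′ =
  trans (cong D (sym (zipWith-++ _∨_ X Y X′ Y′))) (¬-not λ eqD →
    avoid (zipWith σ U U′) (A ⊥)
      (cong A (trans (at false false (λ _ _ → false)
        (λ { true _ → refl ; false true → refl ; false false → refl }))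
        (trans (zipWith-ignoreʳ (λ _ → false) U U′) (map-const U false))))
      (trans (cong B (trans (at false true (λ x y → not x ∧ y)
        (λ { true _ → refl ; false true → refl ; false false → refl }))
        (trans (sym (zipWith-map₁ _∧_ not U U′)) (∁∩-++ X X′ Y Y′)))) (cancel (D≡¬B _) eq′))
      (trans (cong C (trans (at true false (λ x _ → x)
        (λ { true _ → refl ; false true → refl ; false false → refl }))
        (trans (zipWith-ignoreʳ id U U′) (map-id U)))) (cancel (D≡¬C _) eq))
      (trans (cong D (at true true _∨_
        (λ { true _ → refl ; false true → refl ; false false → refl }))) eqD))
  where
  U  = X ++ Y
  U′ = X′ ++ Y′

  σ : Bool → Bool → Bool ⊎ Fin 2
  σ true  _     = 𝕩
  σ false true  = 𝕪
  σ false false = inj₁ false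

  at : ∀ a b k → (∀ x y → [ id , lookup (a ∷ b ∷ []) ]′ (σ x y) ≡ k x y) →
       zipWith σ U U′ ⟪ a , b ⟫ ≡ zipWith k U U′
  at a b k table = zipWith-[] (a ∷ b ∷ []) table U U′

  cancel : ∀ {x y z} → x ≡ not y → x ≡ not z → y ≡ z
  cancel p q = not-injective (trans (sym p) q)

-- Two oppositions and the contradiction.

avoiding : ∀ ns f → Bichromatic (2 ∷ ns) f →
           Avoiding (λ Z → f (false ∷ false ∷ Z)) (λ Z → f (false ∷ true ∷ Z))
                    (λ Z → f (true ∷ false ∷ Z)) (λ Z → f (true ∷ true ∷ Z))
avoiding ns f (lines , _) =
  avoids λ τ b eqA eqB eqC eqD → clash τ eqA eqB eqC eqD (lines τ (not b))
  where
  clash : ∀ τ {b} →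
          f (false ∷ false ∷ τ ⟪ false , false ⟫) ≡ b → f (false ∷ true ∷ τ ⟪ false , true ⟫) ≡ b →
          f (true ∷ false ∷ τ ⟪ true , false ⟫) ≡ b → f (true ∷ true ∷ τ ⟪ true , true ⟫) ≡ b →
          ¬ (∃[ a ] f (a ++ τ [ a ]) ≡ not b)
  clash τ eqA eqB eqC eqD (false ∷ false ∷ [] , eq) = not-¬ eqA eq
  clash τ eqA eqB eqC eqD (false ∷ true  ∷ [] , eq) = not-¬ eqB eq
  clash τ eqA eqB eqC eqD (true  ∷ false ∷ [] , eq) = not-¬ eqC eq
  clash τ eqA eqB eqC eqD (true  ∷ true  ∷ [] , eq) = not-¬ eqD eq

not-bichromatic : ∀ m₁ k₁ m₂ k₂ m ks f → m < length ks →
                  ¬ Bichromatic (2 ∷ m₁ ∷ k₁ ∷ m₂ ∷ k₂ ∷ m ∷ ks) f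
not-bichromatic m₁ k₁ m₂ k₂ m ks f m<l bi@(_ , below)
  with avoid ← avoiding (m₁ ∷ k₁ ∷ m₂ ∷ k₂ ∷ m ∷ ks) f bi
  with opposition m₁ k₁ (m₂ ∷ k₂ ∷ m ∷ ks)
         (below (false ∷ false ∷ [])) (below (false ∷ true ∷ [])) avoid
... | K , D≡¬C
  -- After the swap C stands second, so the next fixing sets it to 1 on the same sections as D and
  -- their opposition survives.
  with avoid′ ← avoiding-swap (avoiding-fixing {m₁} {k₁} K avoid)
  with opposition m₂ k₂ (m ∷ ks) (proj₂ (proj₂ (below (false ∷ false ∷ [])) K) ⊤)
         (proj₂ (proj₂ (below (true ∷ false ∷ [])) K) ⊤) avoid′
... | L , D≡¬B = closed-section m ks
  (fixing {m₂} {k₂} ⊤ (fixing {m₁} {k₁} ⊤ λ Z → f (true ∷ true ∷ Z))) m<l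
  (proj₂ (proj₂ (proj₂ (proj₂ (below (true ∷ true ∷ [])) ⊤) ⊤) ⊤) ⊤)
  (opposite⇒closed (avoiding-fixing {m₂} {k₂} L avoid′)
    (λ Z → D≡¬C (⊤ {m₂} ++ (⊤ {k₂} ++ Z))) D≡¬B)

theorem4p6 : (n : ℕ → ℕ) → (∀ i → 0 < n i) → n 0 ≡ 2 →
    (n ∉ ENSH²₂-seq) × (∃[ r ] (0 < r × ¬ ENSH²₂ (applyUpTo n r)))
theorem4p6 n _ n₀≡2 = (λ (_ , ensh) → refute (ensh r 0<r)) , r , 0<r , refute
  where
  -- One section of size 2, four for the two oppositions, one of size `n 5` for the final line, and
  -- `n 5 + 1` for the words that `captured` chooses.
  r = 7 + n 5
  0<r = s≤s z≤n

  late tail : List ℕ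
  late = applyUpTo (λ i → n (6 + i)) (1 + n 5)
  tail = applyUpTo (λ i → n (suc i)) (6 + n 5)

  refute-2 : ¬ ENSH²₂ (2 ∷ tail)
  refute-2 (f , ¬sh) = not-bichromatic (n 1) (n 2) (n 3) (n 4) (n 5) late f
    (≤-reflexive (sym (length-applyUpTo (λ i → n (6 + i)) (1 + n 5))))
    (bichromatic (2 ∷ tail) f (¬sh ∘ Line⇒SectionallyHomogeneous (2 ∷ tail) f))

  refute : ¬ ENSH²₂ (applyUpTo n r)
  refute = subst (λ n₀ → ¬ ENSH²₂ (n₀ ∷ tail)) (sym n₀≡2) refute-2
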